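{- Let $n, r, d$ be positive integers with $n\geqslant r+1$. Then $m_e(K_n^d, r)=\binom{d+r}{d+1}$.
   Context: All graphs are finite, simple and undirected. Given graphs $G$ and $H$, the $H$-bootstrap percolation process on $G$ starts with a set $E_0\subseteq E(G)$ of initially activated edges, and for $i\geqslant 1$, $E_i$ is $E_{i-1}$ together with every edge $e\in E(G)$ for which there is a subgraph $H_e$ of $G$ isomorphic to $H$ with $e\in E(H_e)$ and $E(H_e)\setminus\{e\}\subseteq E_{i-1}$. $E_0$ is a percolating set if $\bigcup_{i\geqslant0}E_i=E(G)$. The weak saturation number $\mathrm{wsat}(G,H)$ is the minimum size of a percolating set in this process. For an integer $r\geqslant 0$, $m_e(G,r)=\mathrm{wsat}(G,S_{r+1})$, where $S_{r+1}$ is the star graph on $r+2$ vertices (one center joined to $r+1$ leaves). $K_n^d$ is the Cartesian product of $d$ copies of the complete graph $K_n$: vertex set $\{0,\ldots,n-1\}^d$, two vertices adjacent iff they differ in exactly one coordinate. -}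

module Defs where

open import Data.Nat using (ℕ; zero; suc)
open import Data.Fin using (Fin)
open import Data.Vec using (Vec; lookup)
open import Data.List using (List; length)
open import Data.List.Membership.Propositional using (_∈_)
open import Data.List.Relation.Unary.Unique.Propositional using (Unique)
open import Data.Product using (Σ; ∃; _×_; _,_)
open import Data.Sum using (_⊎_)
open import Relation.Binary.PropositionalEquality using (_≡_; _≢_)
open import Level using (0ℓ)

Vtx : ℕ → ℕ → Set
Vtx n d = Vec (Fin n) d

AdjK : (n d : ℕ) → Vtx n d → Vtx n d → Set
AdjK n d x y = Σ (Fin d) λ k → (lookup x k ≢ lookup y k)
                 × ((j : Fin d) → j ≢ k → lookup x j ≡ lookup y j)

-- A finite simple graph is given by a vertex type V and a (symmetric,
-- irreflexive) adjacency relation Adj; an edge {u,v} is represented by an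
-- ordered pair (u , v) with Adj u v, and (u , v), (v , u) denote the same edge.
-- An initial edge set E₀ is given as a list of such pairs.

module Bootstrap {V : Set} (Adj : V → V → Set) where

  InList : List (V × V) → V → V → Set
  InList E₀ u v = ((u , v) ∈ E₀) ⊎ ((v , u) ∈ E₀)

  -- There is a subgraph of G isomorphic to the star S_{r+1} (center c, a set L
  -- of r+1 distinct neighbours of c as leaves) containing the edge {c,w}
  -- (w ∈ L), all of whose other edges {c,x} (x ∈ L, x ≠ w) lie in A.
  StarWith : ℕ → (V → V → Set) → V → V → Set
  StarWith r A c w =
    Σ (List V) λ L → (length L ≡ suc r) × Unique L
      × ((x : V) → x ∈ L → Adj c x)
      × (w ∈ L)
      × ((x : V) → x ∈ L → x ≢ w → A c x)

  Stage : ℕ → List (V × V) → ℕ → V → V → Set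
  Stage r E₀ zero    u v = InList E₀ u v
  Stage r E₀ (suc i) u v =
    Stage r E₀ i u v
    ⊎ (Adj u v × (StarWith r (Stage r E₀ i) u v ⊎ StarWith r (Stage r E₀ i) v u))

  EdgeList : List (V × V) → Set
  EdgeList E₀ = (u v : V) → (u , v) ∈ E₀ → Adj u v

  Percolates : ℕ → List (V × V) → Set
  Percolates r E₀ = (u v : V) → Adj u v → ∃ λ i → Stage r E₀ i u v

  MeEquals : ℕ → ℕ → Set
  MeEquals r m =
    (Σ (List (V × V)) λ E₀ → EdgeList E₀ × Unique E₀ × Percolates r E₀ × length E₀ ≡ m)
    × ((E₀ : List (V × V)) → EdgeList E₀ → Percolates r E₀ → m Data.Nat.≤ length E₀)

{-# OPTIONS --safe #-}

-- Lower bound: let P be a symmetric integer polynomial in d + 1 variables, of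
-- degree less than r in each of them. Give the value (k , y) of coordinate k
-- its own integer code, and label the edge joining u to its neighbour with
-- k-th coordinate y by P (code of (k , y), codes of the coordinates of u).
-- Symmetry makes this independent of the chosen endpoint. Around a vertex the
-- labels are values at distinct points of a polynomial of degree less than r,
-- so if r of them vanish then all do. Hence if the labels of a percolating set
-- vanish, all labels vanish, and then P = 0. As such P form a space of
-- dimension (d + r) C (d + 1), a smaller percolating set would contradict
-- linear algebra.
--
-- Upper bound: take the edges at x in the first direction which raise the
-- first coordinate by 1, …, r ∸ |x|, where |x| is the coordinate sum. They
-- correspond to the points of ℕ^(d+1) with coordinate sum less than r.
-- Deduplication only shortens the list, and by the lower bound not at all.
module Submission where

open import Defs
open import Data.Nat using (ℕ; zero; suc; _+_; _∸_; _≤_; _<_; s≤s; z≤n; s≤s⁻¹)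
open import Data.Nat.Combinatorics using (_C_; nC1≡n; nCk+nC[k+1]≡[n+1]C[k+1]; k>n⇒nCk≡0)
open import Data.Nat.Properties
open import Data.Integer as ℤ using (ℤ; 0ℤ; 1ℤ)
open import Data.Integer.Properties as ℤ using ()
open import Data.Integer.Tactic.RingSolver using (solve-∀)
open import Algebra.Properties.AbelianGroup ℤ.+-0-abelianGroup using () renaming (∙-cancelˡ to ℤ-+-cancelˡ)
open import Data.Vec.Relation.Unary.All as VecAll using ([]; _∷_)
import Data.Vec.Relation.Unary.All.Properties as VecAll
open import Data.Vec.Relation.Unary.AllPairs using ([]; _∷_)
import Data.Vec.Relation.Unary.Unique.Propositional as VecUnique
import Data.Vec.Relation.Unary.Unique.Propositional.Properties as VecUnique
open import Data.List.Relation.Unary.AllPairs using ([]; _∷_)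
open import Relation.Binary.Definitions using (DecidableEquality; tri<; tri≈; tri>)
open import Relation.Binary.PropositionalEquality
open import Data.Fin as Fin using (Fin; zero; suc; toℕ; combine; punchIn; inject≤)
import Data.Fin.Properties as Fin
open import Data.Vec as Vec using (Vec; []; _∷_; lookup; tabulate)
open import Data.Vec.Properties as Vec using (lookup∘tabulate)
open import Data.List as List using (List; []; _∷_; length; _++_)
open import Data.List.Membership.Propositional using (_∈_)
open import Data.List.Membership.Propositional.Properties using
  (∈-map⁺; ∈-map⁻; ∈-++⁺ˡ; ∈-++⁺ʳ; ∈-filter⁺; ∈-filter⁻; ∈-deduplicate⁺; ∈-deduplicate⁻)
import Data.List.Membership.DecPropositional as DecMembership
open import Data.List.Properties using
  (length-map; length-tabulate; length-++; length-take; length-filter; length-deduplicate)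
open import Data.List.Relation.Unary.Any using (here; there)
open import Data.List.Relation.Unary.All as All using (All; []; _∷_)
import Data.List.Relation.Unary.All.Properties as All
open import Data.List.Relation.Unary.Unique.Propositional using (Unique)
import Data.List.Relation.Unary.Unique.Propositional.Properties as Unique
import Data.List.Relation.Unary.Unique.DecPropositional.Properties as DecUnique
open import Data.Product using (∃; _×_; _,_; proj₁; proj₂; uncurry)
open import Data.Product.Properties using () renaming (≡-dec to ×-≡-dec)
open import Data.Sum using (_⊎_; inj₁; inj₂)
open import Function using (_∘_; id; case_of_)
open import Relation.Nullary using (¬_; Dec; yes; no; contradiction)
open import Relation.Nullary.Decidable using (¬?; _×-dec_; _→-dec_)

-- Integer polynomials in one variable, defined by divided differences

-- Divided differences replace coefficients: at every point `a` the quotient `g` has a degree bound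
-- one lower. Quantifying over all `a` lets any root be factored out.
Deg< : ℕ → (ℤ → ℤ) → Set
Deg< zero    f = ∀ t → f t ≡ 0ℤ
Deg< (suc r) f = ∀ a → ∃ λ g → Deg< r g × (∀ t → f t ≡ f a ℤ.+ (t ℤ.- a) ℤ.* g t)

Deg<-cong : ∀ r {f g} → (∀ t → f t ≡ g t) → Deg< r f → Deg< r g
Deg<-cong zero    eq f<r t = trans (sym (eq t)) (f<r t)
Deg<-cong (suc r) eq f<r a with f<r a
... | h , h<r , split = h , h<r , λ t →
  trans (sym (eq t)) (trans (split t) (cong (ℤ._+ _) (eq a)))

Deg<-0 : ∀ r → Deg< r (λ _ → 0ℤ)
Deg<-0 zero    t = refl
Deg<-0 (suc r) a = (λ _ → 0ℤ) , Deg<-0 r , λ t → sym (identity t a)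
  where
  identity : ∀ t a → 0ℤ ℤ.+ (t ℤ.- a) ℤ.* 0ℤ ≡ 0ℤ
  identity = solve-∀

Deg<-const : ∀ r c → Deg< (suc r) (λ _ → c)
Deg<-const r c a = (λ _ → 0ℤ) , Deg<-0 r , λ t → sym (identity t a c)
  where
  identity : ∀ t a c → c ℤ.+ (t ℤ.- a) ℤ.* 0ℤ ≡ c
  identity = solve-∀

Deg<-+ : ∀ r {f g} → Deg< r f → Deg< r g → Deg< r (λ t → f t ℤ.+ g t)
Deg<-+ zero    f<r g<r t rewrite f<r t | g<r t = refl
Deg<-+ (suc r) {f} {g} f<r g<r a with f<r a | g<r a
... | f′ , f′<r , f-split | g′ , g′<r , g-split =
  (λ t → f′ t ℤ.+ g′ t) , Deg<-+ r f′<r g′<r , λ t →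
  trans (cong₂ ℤ._+_ (f-split t) (g-split t)) (identity (f a) (g a) (t ℤ.- a) (f′ t) (g′ t))
  where
  identity : ∀ x y d p q → (x ℤ.+ d ℤ.* p) ℤ.+ (y ℤ.+ d ℤ.* q) ≡ (x ℤ.+ y) ℤ.+ d ℤ.* (p ℤ.+ q)
  identity = solve-∀

-- The quotient at `a` is `v * f a` plus the same affine factor times the quotient of `f`, so the
-- bound follows by induction. Affine factors suffice because the weights below are affine in each
-- variable.
Deg<-affine* : ∀ r u v {f} → Deg< r f → Deg< (suc r) (λ t → (u ℤ.+ t ℤ.* v) ℤ.* f t)
Deg<-affine* zero u v f<r a = (λ _ → 0ℤ) , (λ _ → refl) , λ t →
  trans (vanish t) (sym (trans (cong (ℤ._+ _) (vanish a)) (identity (t ℤ.- a))))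
  where
  vanish : ∀ t → (u ℤ.+ t ℤ.* v) ℤ.* _ ≡ 0ℤ
  vanish t = trans (cong ((u ℤ.+ t ℤ.* v) ℤ.*_) (f<r t)) (ℤ.*-zeroʳ (u ℤ.+ t ℤ.* v))
  identity : ∀ d → 0ℤ ℤ.+ d ℤ.* 0ℤ ≡ 0ℤ
  identity = solve-∀
Deg<-affine* (suc r) u v {f} f<r a with f<r a
... | g , g<r , split =
  (λ t → v ℤ.* f a ℤ.+ (u ℤ.+ t ℤ.* v) ℤ.* g t) ,
  Deg<-+ (suc r) (Deg<-const r (v ℤ.* f a)) (Deg<-affine* r u v g<r) , λ t →
  trans (cong ((u ℤ.+ t ℤ.* v) ℤ.*_) (split t)) (identity u v t a (f a) (g t))
  where
  identity : ∀ u v t a p q → (u ℤ.+ t ℤ.* v) ℤ.* (p ℤ.+ (t ℤ.- a) ℤ.* q) ≡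
    (u ℤ.+ a ℤ.* v) ℤ.* p ℤ.+ (t ℤ.- a) ℤ.* (v ℤ.* p ℤ.+ (u ℤ.+ t ℤ.* v) ℤ.* q)
  identity = solve-∀

*-≢0 : ∀ {x y} → x ≢ 0ℤ → y ≢ 0ℤ → x ℤ.* y ≢ 0ℤ
*-≢0 {x} x≢0 y≢0 xy≡0 with ℤ.i*j≡0⇒i≡0∨j≡0 x xy≡0
... | inj₁ x≡0 = x≢0 x≡0
... | inj₂ y≡0 = y≢0 y≡0

*-cancelˡ-0 : ∀ x {y} → x ≢ 0ℤ → x ℤ.* y ≡ 0ℤ → y ≡ 0ℤ
*-cancelˡ-0 x x≢0 xy≡0 with ℤ.i*j≡0⇒i≡0∨j≡0 x xy≡0
... | inj₁ x≡0 = contradiction x≡0 x≢0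
... | inj₂ y≡0 = y≡0

-≢0 : ∀ x y → x ≢ y → x ℤ.- y ≢ 0ℤ
-≢0 x y x≢y = x≢y ∘ ℤ.i-j≡0⇒i≡j x y

-- The roots are indexed by the elements of a list of labels, through a
-- relation under which distinct labels have distinct roots.
Deg<-roots : ∀ {X : Set} (Root : X → ℤ → Set) →
  (∀ {x y a} → Root x a → Root y a → x ≡ y) →
  ∀ r {f} → Deg< r f → (L : List X) → Unique L → r ≤ length L →
  All (λ x → ∃ λ a → Root x a × f a ≡ 0ℤ) L → ∀ t → f t ≡ 0ℤ
Deg<-roots Root inj zero f<r _ _ _ _ t = f<r t
Deg<-roots Root inj (suc r) {f} f<r (x ∷ L) (x∉L ∷ L!) (s≤s r≤) ((a , xRa , fa≡0) ∷ roots) t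
  with f<r a
... | g , g<r , split = begin
  f t                          ≡⟨ split′ t ⟩
  (t ℤ.- a) ℤ.* g t            ≡⟨ cong ((t ℤ.- a) ℤ.*_) (Deg<-roots Root inj r g<r L L! r≤ roots′ t) ⟩
  (t ℤ.- a) ℤ.* 0ℤ             ≡⟨ ℤ.*-zeroʳ (t ℤ.- a) ⟩
  0ℤ                           ∎
  where
  open ≡-Reasoning
  split′ : ∀ t → f t ≡ (t ℤ.- a) ℤ.* g t
  split′ t = trans (split t) (trans (cong (ℤ._+ _) fa≡0) (ℤ.+-identityˡ _))
  -- A root `b` with another label differs from `a`, so the factor `b - a` cancels and `b` is a root
  -- of `g`.
  roots′ : All (λ y → ∃ λ b → Root y b × g b ≡ 0ℤ) L
  roots′ = All.zipWith (λ { (x≢y , b , yRb , fb≡0) → b , yRb ,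
    *-cancelˡ-0 (b ℤ.- a) (-≢0 b a λ { refl → x≢y (inj xRa yRb) }) (trans (sym (split′ b)) fb≡0) }) (x∉L , roots)

-- Integer vectors and homogeneous linear systems

Zero : ∀ {n} → Vec ℤ n → Set
Zero = VecAll.All (_≡ 0ℤ)

dot : ∀ {n} → Vec ℤ n → Vec ℤ n → ℤ
dot []      []      = 0ℤ
dot (x ∷ c) (y ∷ φ) = x ℤ.* y ℤ.+ dot c φ

dot-++ : ∀ {m n} (c : Vec ℤ m) {c′ : Vec ℤ n} φ {φ′} →
  dot (c Vec.++ c′) (φ Vec.++ φ′) ≡ dot c φ ℤ.+ dot c′ φ′
dot-++ []      []      = sym (ℤ.+-identityˡ _)
dot-++ (x ∷ c) (y ∷ φ) =
  trans (cong (ℤ._+_ (x ℤ.* y)) (dot-++ c φ)) (sym (ℤ.+-assoc (x ℤ.* y) _ _))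

scale : ∀ {n} → ℤ → Vec ℤ n → Vec ℤ n
scale a = Vec.map (a ℤ.*_)

dot-scaleʳ : ∀ {n} a (c φ : Vec ℤ n) → dot c (scale a φ) ≡ a ℤ.* dot c φ
dot-scaleʳ a []      []      = sym (ℤ.*-zeroʳ a)
dot-scaleʳ a (x ∷ c) (y ∷ φ) =
  trans (cong (ℤ._+_ (x ℤ.* (a ℤ.* y))) (dot-scaleʳ a c φ)) (identity a x y (dot c φ))
  where
  identity : ∀ a x y p → x ℤ.* (a ℤ.* y) ℤ.+ a ℤ.* p ≡ a ℤ.* (x ℤ.* y ℤ.+ p)
  identity = solve-∀

dot-zeroˡ : ∀ {n} {c : Vec ℤ n} → Zero c → ∀ φ → dot c φ ≡ 0ℤ
dot-zeroˡ []         []      = refl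
dot-zeroˡ (refl ∷ z) (y ∷ φ) = trans (ℤ.+-identityˡ _) (dot-zeroˡ z φ)

-- Fraction-free Gaussian elimination: the row `a ∷ φ` clears the leading entry `b` by
-- cross-multiplication, so everything stays integral.
eliminate : ∀ {n} → ℤ → Vec ℤ n → Vec ℤ (suc n) → Vec ℤ n
eliminate a φ (b ∷ ψ) = Vec.zipWith (λ p q → a ℤ.* q ℤ.- b ℤ.* p) φ ψ

-- The vector on the left lifts a solution `c` of the eliminated system: its leading entry is chosen
-- to solve the pivot equation (`dot-pivot`), and scaling by `a` avoids division.
dot-eliminate : ∀ {n} a (φ : Vec ℤ n) ψ c →
  dot (ℤ.- dot c φ ∷ scale a c) ψ ≡ dot c (eliminate a φ ψ)
dot-eliminate a []      (b ∷ [])    []      = refl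
dot-eliminate a (p ∷ φ) (b ∷ q ∷ ψ) (x ∷ c) = begin
  ℤ.- (x ℤ.* p ℤ.+ dot c φ) ℤ.* b ℤ.+ (a ℤ.* x ℤ.* q ℤ.+ dot (scale a c) ψ)
    ≡⟨ identity a b x p q (dot c φ) (dot (scale a c) ψ) ⟩
  x ℤ.* (a ℤ.* q ℤ.- b ℤ.* p) ℤ.+ (ℤ.- dot c φ ℤ.* b ℤ.+ dot (scale a c) ψ)
    ≡⟨ cong (ℤ._+_ (x ℤ.* (a ℤ.* q ℤ.- b ℤ.* p))) (dot-eliminate a φ (b ∷ ψ) c) ⟩
  x ℤ.* (a ℤ.* q ℤ.- b ℤ.* p) ℤ.+ dot c (eliminate a φ (b ∷ ψ)) ∎
  where
  open ≡-Reasoning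
  identity : ∀ a b x p q d e → ℤ.- (x ℤ.* p ℤ.+ d) ℤ.* b ℤ.+ (a ℤ.* x ℤ.* q ℤ.+ e) ≡
    x ℤ.* (a ℤ.* q ℤ.- b ℤ.* p) ℤ.+ (ℤ.- d ℤ.* b ℤ.+ e)
  identity = solve-∀

dot-pivot : ∀ {n} a (φ : Vec ℤ n) c → dot (ℤ.- dot c φ ∷ scale a c) (a ∷ φ) ≡ 0ℤ
dot-pivot a φ c = trans (cong (ℤ._+_ (ℤ.- dot c φ ℤ.* a)) (dot-scaleˡ c φ)) (identity a (dot c φ))
  where
  identity : ∀ a d → ℤ.- d ℤ.* a ℤ.+ a ℤ.* d ≡ 0ℤ
  identity = solve-∀
  distrib : ∀ a x y p → a ℤ.* x ℤ.* y ℤ.+ a ℤ.* p ≡ a ℤ.* (x ℤ.* y ℤ.+ p)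
  distrib = solve-∀
  dot-scaleˡ : ∀ {n} (c φ : Vec ℤ n) → dot (scale a c) φ ≡ a ℤ.* dot c φ
  dot-scaleˡ []      []      = sym (ℤ.*-zeroʳ a)
  dot-scaleˡ (x ∷ c) (y ∷ φ) =
    trans (cong (ℤ._+_ (a ℤ.* x ℤ.* y)) (dot-scaleˡ c φ)) (distrib a x y (dot c φ))

-- The list Φ is a rearrangement of (coeff ∷ row) ∷ rest; only the
-- consequence for All is recorded.
record Pivot {n} (Φ : List (Vec ℤ (suc n))) : Set₁ where
  constructor mkPivot
  field
    coeff   : ℤ
    row     : Vec ℤ n
    rest    : List (Vec ℤ (suc n))
    coeff≢0 : coeff ≢ 0ℤ
    size    : length Φ ≡ suc (length rest)
    cover   : {P : Vec ℤ (suc n) → Set} → P (coeff ∷ row) → All P rest → All P Φ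

findPivot : ∀ {n} (Φ : List (Vec ℤ (suc n))) → All (λ φ → Vec.head φ ≡ 0ℤ) Φ ⊎ Pivot Φ
findPivot [] = inj₁ []
findPivot ((a ∷ φ) ∷ Φ) with a ℤ.≟ 0ℤ | findPivot Φ
... | no a≢0  | _        = inj₂ (mkPivot a φ Φ a≢0 refl _∷_)
... | yes a≡0 | inj₁ Φ₀  = inj₁ (a≡0 ∷ Φ₀)
... | yes _   | inj₂ (mkPivot b ψ Ψ b≢0 size cover) =
  inj₂ (mkPivot b ψ ((a ∷ φ) ∷ Ψ) b≢0 (cong suc size) λ { p (q ∷ qs) → q ∷ cover p qs })

-- Induction on the number of unknowns: a pivot removes one equation and one unknown, so there
-- remain fewer equations than unknowns.
kernel : ∀ {n} (Φ : List (Vec ℤ n)) → length Φ < n →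
  ∃ λ c → ¬ Zero c × All (λ φ → dot c φ ≡ 0ℤ) Φ
kernel {suc n} Φ Φ<n with findPivot Φ
-- No row involves the first unknown, so the first unit vector is a solution.
... | inj₁ Φ₀ = 1ℤ ∷ zeros , (λ { (() ∷ _) }) , All.map (λ {φ} → first {φ}) Φ₀
  where
  zeros : Vec ℤ n
  zeros = Vec.replicate n 0ℤ
  zeros-Zero : ∀ n → Zero (Vec.replicate n 0ℤ)
  zeros-Zero zero    = []
  zeros-Zero (suc n) = refl ∷ zeros-Zero n
  first : ∀ {φ} → Vec.head φ ≡ 0ℤ → dot (1ℤ ∷ zeros) φ ≡ 0ℤ
  first {_ ∷ φ} refl = trans (ℤ.+-identityˡ _) (dot-zeroˡ (zeros-Zero n) φ)
... | inj₂ (mkPivot a φ Ψ a≢0 size cover) with kernel (List.map (eliminate a φ) Ψ)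
  (subst (_< n) (sym (length-map (eliminate a φ) Ψ)) (subst (_≤ n) size (s≤s⁻¹ Φ<n)))
... | c , c≢0 , c⊥ = ℤ.- dot c φ ∷ scale a c ,
  (λ { (_ ∷ ac≡0) → c≢0 (VecAll.map (*-cancelˡ-0 a a≢0) (VecAll.map⁻ ac≡0)) }) ,
  cover (dot-pivot a φ c) (All.map (λ {ψ} eq → trans (dot-eliminate a φ ψ c) eq) (All.map⁻ c⊥))

-- Symmetric polynomials of degree less than r in each variable

-- The number of monomials of total degree less than `r` in `D` variables, split into those free of
-- the first variable and its multiples. `monomials` and `simplex` follow the same recursion.
count : ℕ → ℕ → ℕ
count D       zero    = 0
count zero    (suc r) = 1
count (suc D) (suc r) = count D (suc r) + count (suc D) r

monomials : ∀ D r → Vec ℤ D → Vec ℤ (count D r)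
monomials D       zero    w       = []
monomials zero    (suc r) w       = 1ℤ ∷ []
monomials (suc D) (suc r) (x ∷ w) =
  monomials D (suc r) w Vec.++ scale x (monomials (suc D) r (x ∷ w))

count≡C : ∀ d r → count (suc d) r ≡ (d + r) C (suc d)
count≡C d       zero    = sym (k>n⇒nCk≡0 (subst (_< suc d) (sym (+-identityʳ d)) ≤-refl))
count≡C zero    (suc r) = trans (cong suc (count≡C zero r)) (trans (cong suc (nC1≡n r)) (sym (nC1≡n (suc r))))
count≡C (suc d) (suc r) = begin
  count (suc d) (suc r) + count (suc (suc d)) r
    ≡⟨ cong₂ _+_ (count≡C d (suc r)) (count≡C (suc d) r) ⟩
  (d + suc r) C suc d + (suc d + r) C suc (suc d)
    ≡⟨ cong (λ m → (d + suc r) C suc d + m C suc (suc d)) (+-suc d r) ⟨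
  (d + suc r) C suc d + (d + suc r) C suc (suc d)
    ≡⟨ nCk+nC[k+1]≡[n+1]C[k+1] (d + suc r) (suc d) ⟩
  (suc d + suc r) C suc (suc d) ∎
  where open ≡-Reasoning

-- The j-th entry of weights b s xs is sⱼ ∏ᵢ (xᵢ − bⱼ). For distinct bⱼ and
-- nonzero sⱼ, as many as there are variables, these products and 1 span over ℚ
-- the symmetric polynomials of degree at most 1 in each variable, so they can
-- replace the elementary symmetric polynomials as algebra generators.
step : ∀ {D} → Vec ℤ D → ℤ → Vec ℤ D → Vec ℤ D
step b x = Vec.zipWith (λ β σ → (x ℤ.- β) ℤ.* σ) b

weights : ∀ {D k} → Vec ℤ D → Vec ℤ D → Vec ℤ k → Vec ℤ D
weights b s []       = s
weights b s (x ∷ xs) = weights b (step b x s) xs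

step-comm : ∀ {D} (b : Vec ℤ D) x y s → step b x (step b y s) ≡ step b y (step b x s)
step-comm []      x y []      = refl
step-comm (β ∷ b) x y (σ ∷ s) = cong₂ _∷_ (identity x y β σ) (step-comm b x y s)
  where
  identity : ∀ x y β σ → (x ℤ.- β) ℤ.* ((y ℤ.- β) ℤ.* σ) ≡ (y ℤ.- β) ℤ.* ((x ℤ.- β) ℤ.* σ)
  identity = solve-∀

lookup-ext : ∀ {A : Set} {k} (xs ys : Vec A k) → (∀ j → lookup xs j ≡ lookup ys j) → xs ≡ ys
lookup-ext []       []       eq = refl
lookup-ext (x ∷ xs) (y ∷ ys) eq = cong₂ _∷_ (eq zero) (lookup-ext xs ys (eq ∘ suc))

-- Both argument lists hold the common entries and the two `i`-th entries, and `step-comm` permits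
-- reordering. This is the symmetry between the two ends of an edge.
weights-exchange : ∀ {D k} (b s : Vec ℤ D) (xs ys : Vec ℤ k) i →
  (∀ j → j ≢ i → lookup xs j ≡ lookup ys j) →
  weights b s (lookup ys i ∷ xs) ≡ weights b s (lookup xs i ∷ ys)
weights-exchange b s (x ∷ xs) (y ∷ ys) zero agree
  rewrite lookup-ext xs ys (λ j → agree (suc j) λ ()) =
  cong (λ s′ → weights b s′ ys) (step-comm b x y s)
weights-exchange b s (x ∷ xs) (y ∷ ys) (suc i) agree rewrite agree zero (λ ()) = begin
  weights b (step b y (step b (lookup ys i) s)) xs
    ≡⟨ cong (λ s′ → weights b s′ xs) (step-comm b y (lookup ys i) s) ⟩
  weights b (step b (lookup ys i) (step b y s)) xs
    ≡⟨ weights-exchange b (step b y s) xs ys i (λ j j≢i → agree (suc j) (j≢i ∘ Fin.suc-injective)) ⟩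
  weights b (step b (lookup xs i) (step b y s)) ys
    ≡⟨ cong (λ s′ → weights b s′ ys) (step-comm b (lookup xs i) y s) ⟩
  weights b (step b y (step b (lookup xs i) s)) ys ∎
  where open ≡-Reasoning

affine : ∀ {D} → Vec ℤ D → Vec ℤ D → ℤ → Vec ℤ D
affine u v t = Vec.zipWith (λ p q → p ℤ.+ t ℤ.* q) u v

step-self-affine : ∀ {D} (b s : Vec ℤ D) → ∃ λ u → ∀ t → step b t s ≡ affine u s t
step-self-affine []      []      = [] , λ t → refl
step-self-affine (β ∷ b) (σ ∷ s) with step-self-affine b s
... | u , eq = (ℤ.- β ℤ.* σ ∷ u) , λ t → cong₂ _∷_ (identity t β σ) (eq t)
  where
  identity : ∀ t β σ → (t ℤ.- β) ℤ.* σ ≡ ℤ.- β ℤ.* σ ℤ.+ t ℤ.* σ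
  identity = solve-∀

step-affine : ∀ {D} (b : Vec ℤ D) x u v t →
  step b x (affine u v t) ≡ affine (step b x u) (step b x v) t
step-affine []      x []      []      t = refl
step-affine (β ∷ b) x (p ∷ u) (q ∷ v) t = cong₂ _∷_ (identity x β p q t) (step-affine b x u v t)
  where
  identity : ∀ x β p q t → (x ℤ.- β) ℤ.* (p ℤ.+ t ℤ.* q) ≡
    (x ℤ.- β) ℤ.* p ℤ.+ t ℤ.* ((x ℤ.- β) ℤ.* q)
  identity = solve-∀

weights-affine : ∀ {D k} (b u v : Vec ℤ D) (xs : Vec ℤ k) t →
  weights b (affine u v t) xs ≡ affine (weights b u xs) (weights b v xs) t
weights-affine b u v []       t = refl
weights-affine b u v (x ∷ xs) t rewrite step-affine b x u v t =
  weights-affine b (step b x u) (step b x v) xs t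

-- Along a line each monomial is a product of fewer than `r` affine functions. Multiples of the
-- first weight spend one factor, handled by `Deg<-affine*`.
Deg<-monomials : ∀ D r c (u v : Vec ℤ D) → Deg< r (λ t → dot c (monomials D r (affine u v t)))
Deg<-monomials D       zero    []       u       v       t = refl
Deg<-monomials zero    (suc r) (x ∷ []) u       v         = Deg<-const r _
Deg<-monomials (suc D) (suc r) c        (p ∷ u) (q ∷ v)   with Vec.splitAt (count D (suc r)) c
... | c₁ , c₂ , refl = Deg<-cong (suc r)
  (λ t → sym (trans (dot-++ c₁ (monomials D (suc r) (affine u v t)))
                    (cong (ℤ._+_ (dot c₁ (monomials D (suc r) (affine u v t))))
                          (dot-scaleʳ (p ℤ.+ t ℤ.* q) c₂ (monomials (suc D) r (affine (p ∷ u) (q ∷ v) t))))))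
  (Deg<-+ (suc r) (Deg<-monomials D (suc r) c₁ u v)
                  (Deg<-affine* r p q (Deg<-monomials (suc D) r c₂ (p ∷ u) (q ∷ v))))

-- Carrying `s` as a parameter makes substitution definitional: `poly r b s c (x ∷ xs)` is
-- `poly r b (step b x s) c xs`.
poly : ∀ {D} r → Vec ℤ D → Vec ℤ D → Vec ℤ (count D r) → ∀ {k} → Vec ℤ k → ℤ
poly r b s c xs = dot c (monomials _ r (weights b s xs))

Deg<-poly : ∀ {D} r (b s : Vec ℤ D) c {k} (xs : Vec ℤ k) → Deg< r (λ t → poly r b s c (t ∷ xs))
Deg<-poly r b s c xs with step-self-affine b s
... | u , eq = Deg<-cong r
  (λ t → cong (λ w → dot c (monomials _ r w))
    (sym (trans (cong (λ s′ → weights b s′ xs) (eq t)) (weights-affine b u s xs t))))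
  (Deg<-monomials _ r c (weights b u xs) (weights b s xs))

embed : ∀ {m k} → (Fin k → Fin m → ℤ) → Vec (Fin m) k → Vec ℤ k
embed A u = tabulate λ i → A i (lookup u i)

-- One variable at a time: at each grid value of the first variable the rest vanishes identically by
-- induction, which gives at least `r` roots in the first variable.
poly-vanishes-from-grid : ∀ {D} r (b s : Vec ℤ D) c {m k} (A : Fin k → Fin m → ℤ) → r ≤ m →
  (∀ i {x y} → A i x ≡ A i y → x ≡ y) →
  (∀ u → poly r b s c (embed A u) ≡ 0ℤ) → ∀ (xs : Vec ℤ k) → poly r b s c xs ≡ 0ℤ
poly-vanishes-from-grid r b s c A r≤m inj vanish []       = vanish []
poly-vanishes-from-grid r b s c {m} A r≤m inj vanish (x ∷ xs) =
  Deg<-roots (λ i a → A zero i ≡ a) (λ eq eq′ → inj zero (trans eq (sym eq′)))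
    r (Deg<-poly r b s c xs) (List.allFin m) (Unique.allFin⁺ m)
    (subst (r ≤_) (sym (length-tabulate {n = m} id)) r≤m)
    (All.universal (λ i → A zero i , refl ,
      poly-vanishes-from-grid r b (step b (A zero i) s) c (A ∘ suc) r≤m (inj ∘ suc)
        (λ u → vanish (i ∷ u)) xs) (List.allFin m))
    x

weight : ∀ {k} → ℤ → ℤ → Vec ℤ k → ℤ
weight β σ []       = σ
weight β σ (x ∷ xs) = weight β ((x ℤ.- β) ℤ.* σ) xs

weights-∷ : ∀ {D k} β σ (b s : Vec ℤ D) (xs : Vec ℤ k) →
  weights (β ∷ b) (σ ∷ s) xs ≡ weight β σ xs ∷ weights b s xs
weights-∷ β σ b s []       = refl
weights-∷ β σ b s (x ∷ xs) = weights-∷ β _ b (step b x s) xs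

weight-0 : ∀ {k} β (xs : Vec ℤ k) → weight β 0ℤ xs ≡ 0ℤ
weight-0 β []       = refl
weight-0 β (x ∷ xs) rewrite ℤ.*-zeroʳ (x ℤ.- β) = weight-0 β xs

weight-≢0 : ∀ {k} β {σ} → σ ≢ 0ℤ → {xs : Vec ℤ k} → VecAll.All (_≢ β) xs → weight β σ xs ≢ 0ℤ
weight-≢0 β σ≢0 []            = σ≢0
weight-≢0 β σ≢0 (x≢β ∷ xs≢β) = weight-≢0 β (*-≢0 (-≢0 _ _ x≢β) σ≢0) xs≢β

step-≢0 : ∀ {D} {b : Vec ℤ D} {s} x → VecAll.All (x ≢_) b → VecAll.All (_≢ 0ℤ) s →
  VecAll.All (_≢ 0ℤ) (step b x s)
step-≢0 {b = []}    {[]}    x []            []            = []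
step-≢0 {b = _ ∷ _} {_ ∷ _} x (x≢β ∷ x≢b) (σ≢0 ∷ s≢0) = *-≢0 (-≢0 _ _ x≢β) σ≢0 ∷ step-≢0 x x≢b s≢0

poly-∷ : ∀ {D k} r β σ (b s : Vec ℤ D) c₁ c₂ (xs : Vec ℤ k) →
  poly (suc r) (β ∷ b) (σ ∷ s) (c₁ Vec.++ c₂) xs ≡
  poly (suc r) b s c₁ xs ℤ.+ weight β σ xs ℤ.* poly r (β ∷ b) (σ ∷ s) c₂ xs
poly-∷ r β σ b s c₁ c₂ xs rewrite weights-∷ β σ b s xs =
  trans (dot-++ c₁ (monomials _ (suc r) (weights b s xs))) (cong (ℤ._+_ (poly (suc r) b s c₁ xs))
    (dot-scaleʳ (weight β σ xs) c₂ (monomials _ r (weight β σ xs ∷ weights b s xs))))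

-- Substituting the first node for a variable kills the first weight and
-- rescales the others, which isolates the coefficients of the monomials
-- without the first weight.
poly-injective : ∀ D r (b s : Vec ℤ D) → VecUnique.Unique b → VecAll.All (_≢ 0ℤ) s →
  ∀ c → (∀ (xs : Vec ℤ D) → poly r b s c xs ≡ 0ℤ) → Zero c
poly-injective D       zero    b s b! s≢0 []       vanish = []
poly-injective zero    (suc r) b s b! s≢0 (x ∷ []) vanish = trans (identity x) (vanish []) ∷ []
  where
  identity : ∀ x → x ≡ x ℤ.* 1ℤ ℤ.+ 0ℤ
  identity = solve-∀
poly-injective (suc D) (suc r) (β ∷ b) (σ ∷ s) (β∉b ∷ b!) (σ≢0 ∷ s≢0) c vanish
  with Vec.splitAt (count D (suc r)) c
... | c₁ , c₂ , refl = VecAll.++⁺ c₁≡0 c₂≡0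
  where
  open ≡-Reasoning
  vanish₁ : ∀ xs → poly (suc r) b (step b β s) c₁ xs ≡ 0ℤ
  vanish₁ xs = begin
    poly (suc r) b s c₁ (β ∷ xs)
      ≡⟨ identity (poly (suc r) b s c₁ (β ∷ xs)) q ⟨
    poly (suc r) b s c₁ (β ∷ xs) ℤ.+ 0ℤ ℤ.* q
      ≡⟨ cong (λ z → poly (suc r) b s c₁ (β ∷ xs) ℤ.+ z ℤ.* q) weight≡0 ⟨
    poly (suc r) b s c₁ (β ∷ xs) ℤ.+ weight β σ (β ∷ xs) ℤ.* q
      ≡⟨ poly-∷ r β σ b s c₁ c₂ (β ∷ xs) ⟨
    poly (suc r) (β ∷ b) (σ ∷ s) (c₁ Vec.++ c₂) (β ∷ xs)
      ≡⟨ vanish (β ∷ xs) ⟩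
    0ℤ ∎
    where
    q = poly r (β ∷ b) (σ ∷ s) c₂ (β ∷ xs)
    weight≡0 : weight β σ (β ∷ xs) ≡ 0ℤ
    weight≡0 = trans (cong (λ z → weight β (z ℤ.* σ) xs) (ℤ.+-inverseʳ β)) (weight-0 β xs)
    identity : ∀ p q → p ℤ.+ 0ℤ ℤ.* q ≡ p
    identity = solve-∀

  c₁≡0 : Zero c₁
  c₁≡0 = poly-injective D (suc r) b (step b β s) b! (step-≢0 β β∉b s≢0) c₁ vanish₁

  -- The values β+1, ..., β+r avoid the node `β`, so the first weight is nonzero on this grid and
  -- cancels. Being `r` in number, they suffice for degree less than `r`.
  A : Fin (suc D) → Fin r → ℤ
  A _ i = β ℤ.+ ℤ.+ suc (toℕ i)

  A≢β : ∀ u → VecAll.All (_≢ β) (embed A u)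
  A≢β u = VecAll.tabulate⁺ λ i eq → case ℤ-+-cancelˡ β (ℤ.+ suc (toℕ (lookup u i))) 0ℤ (trans eq (sym (ℤ.+-identityʳ β))) of λ ()

  vanish₂ : ∀ u → poly r (β ∷ b) (σ ∷ s) c₂ (embed A u) ≡ 0ℤ
  vanish₂ u = *-cancelˡ-0 (weight β σ (embed A u)) (weight-≢0 β σ≢0 (A≢β u)) (begin
    weight β σ xs ℤ.* poly r (β ∷ b) (σ ∷ s) c₂ xs
      ≡⟨ ℤ.+-identityˡ _ ⟨
    0ℤ ℤ.+ weight β σ xs ℤ.* poly r (β ∷ b) (σ ∷ s) c₂ xs
      ≡⟨ cong (ℤ._+ weight β σ xs ℤ.* poly r (β ∷ b) (σ ∷ s) c₂ xs) (dot-zeroˡ c₁≡0 (monomials D (suc r) (weights b s xs))) ⟨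
    poly (suc r) b s c₁ xs ℤ.+ weight β σ xs ℤ.* poly r (β ∷ b) (σ ∷ s) c₂ xs
      ≡⟨ poly-∷ r β σ b s c₁ c₂ xs ⟨
    poly (suc r) (β ∷ b) (σ ∷ s) (c₁ Vec.++ c₂) xs
      ≡⟨ vanish xs ⟩
    0ℤ ∎)
    where xs = embed A u

  c₂≡0 : Zero c₂
  c₂≡0 = poly-injective (suc D) r (β ∷ b) (σ ∷ s) (β∉b ∷ b!) (σ≢0 ∷ s≢0) c₂
    (poly-vanishes-from-grid r (β ∷ b) (σ ∷ s) c₂ A ≤-refl
      (λ _ eq → Fin.toℕ-injective (suc-injective (ℤ.+-injective (ℤ-+-cancelˡ β _ _ eq))))
      vanish₂)

-- Edge labels on the Hamming graph

adj-sym : ∀ {n d} {u v : Vtx n d} → AdjK n d u v → AdjK n d v u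
adj-sym (k , uₖ≢vₖ , agree) = k , uₖ≢vₖ ∘ sym , λ j j≢k → sym (agree j j≢k)

adj-direction-unique : ∀ {n d} {u v : Vtx n d} (p q : AdjK n d u v) → proj₁ p ≡ proj₁ q
adj-direction-unique (k , uₖ≢vₖ , _) (l , _ , agree) with k Fin.≟ l
... | yes k≡l = k≡l
... | no k≢l = contradiction (agree k k≢l) uₖ≢vₖ

adj-head : ∀ {n d} {y i : Fin n} {x : Vtx n d} → y ≢ i → AdjK n (suc d) (i ∷ x) (y ∷ x)
adj-head y≢i = zero , y≢i ∘ sym , λ { zero 0≢0 → contradiction refl 0≢0 ; (suc j) _ → refl }

adj-tail : ∀ {n d} {i : Fin n} {x y : Vtx n d} → AdjK n d x y → AdjK n (suc d) (i ∷ x) (i ∷ y)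
adj-tail (k , xₖ≢yₖ , agree) = suc k , xₖ≢yₖ ,
  λ { zero _ → refl ; (suc j) j≢k → agree j (j≢k ∘ cong suc) }

-- Directions are separated as well as values, so that the neighbours of a vertex in all directions
-- together give distinct evaluation points.
code : ∀ {n d} → Fin d → Fin n → ℤ
code k y = ℤ.+ toℕ (combine k y)

code-injective : ∀ {n d} {k l : Fin d} {x y : Fin n} → code k x ≡ code l y → k ≡ l × x ≡ y
code-injective {k = k} {l} {x} {y} eq =
  Fin.combine-injective k x l y (Fin.toℕ-injective (ℤ.+-injective eq))

nodes ones : ∀ D → Vec ℤ D
nodes D = tabulate (λ i → ℤ.+ toℕ i)
ones D = tabulate (λ _ → 1ℤ)

-- The label of the edge for coefficients `c` is `dot c` of this row, so requiring labels to vanish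
-- is a homogeneous linear system in `c`.
edgeRow : ∀ {n d} r → Vtx n d → Fin d → Fin n → Vec ℤ (count (suc d) r)
edgeRow {d = d} r u k y =
  monomials (suc d) r (weights (nodes (suc d)) (ones (suc d)) (code k y ∷ embed code u))

edgeRow-sym : ∀ {n d} r {u v : Vtx n d} (p : AdjK n d u v) →
  edgeRow r u (proj₁ p) (lookup v (proj₁ p)) ≡ edgeRow r v (proj₁ p) (lookup u (proj₁ p))
edgeRow-sym {d = d} r {u} {v} (k , _ , agree) = cong (monomials (suc d) r) (begin
  weights b s (code k (lookup v k) ∷ embed code u)
    ≡⟨ cong (λ a → weights b s (a ∷ embed code u)) (lookup∘tabulate (codes v) k) ⟨
  weights b s (lookup (embed code v) k ∷ embed code u)
    ≡⟨ weights-exchange b s (embed code u) (embed code v) k agree′ ⟩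
  weights b s (lookup (embed code u) k ∷ embed code v)
    ≡⟨ cong (λ a → weights b s (a ∷ embed code v)) (lookup∘tabulate (codes u) k) ⟩
  weights b s (code k (lookup u k) ∷ embed code v) ∎)
  where
  open ≡-Reasoning
  b = nodes (suc d)
  s = ones (suc d)
  codes : Vtx _ d → Fin d → ℤ
  codes w i = code i (lookup w i)
  agree′ : ∀ j → j ≢ k → lookup (embed code u) j ≡ lookup (embed code v) j
  agree′ j j≢k = trans (lookup∘tabulate (codes u) j)
    (trans (cong (code j) (agree j j≢k)) (sym (lookup∘tabulate (codes v) j)))

-- The direction is read off the adjacency proof, and non-adjacent pairs satisfy the condition
-- vacuously.
Vanishes : ∀ {n d} r → Vec ℤ (count (suc d) r) → Vtx n d → Vtx n d → Set
Vanishes {n} {d} r c u v = (p : AdjK n d u v) → dot c (edgeRow r u (proj₁ p) (lookup v (proj₁ p))) ≡ 0ℤ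

vanishes-sym : ∀ {n d} r c {u v : Vtx n d} → Vanishes r c u v → Vanishes r c v u
vanishes-sym r c {u} {v} vanish p =
  trans (cong (dot c) (edgeRow-sym r {v} {u} p)) (vanish (adj-sym {u = v} {u} p))

-- Propagation of zero labels and the lower bound

remove : ∀ {X : Set} {w : X} {L : List X} → Unique L → w ∈ L →
  ∃ λ L′ → Unique L′ × length L ≡ suc (length L′) × All (λ x → x ∈ L × x ≢ w) L′
remove {L = x ∷ L} (x∉L ∷ L!) (here refl) =
  L , L! , refl , All.tabulate (λ y∈L → there y∈L , λ { refl → All.lookup x∉L y∈L refl })
remove {L = x ∷ L} (x∉L ∷ L!) (there w∈L) with remove L! w∈L
... | L′ , L′! , size , L′⊆ =
  x ∷ L′ , All.map (λ { (y∈L , _) → All.lookup x∉L y∈L }) L′⊆ ∷ L′! , cong suc size ,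
  (here refl , All.lookup x∉L w∈L) ∷ All.map (λ { (y∈L , y≢w) → there y∈L , y≢w }) L′⊆

-- The star without `w` supplies `r` distinct roots of the label polynomial at `u`, so it is zero.
-- Hence every edge at `u`, not only the one to `w`, gets label 0.
star-vanishes : ∀ {n d} r c {A : Vtx n d → Vtx n d → Set} {u w} →
  (∀ {v} → A u v → Vanishes r c u v) → Bootstrap.StarWith (AdjK n d) r A u w →
  ∀ {v} → Vanishes r c u v
star-vanishes {n} {d} r c {A} {u} vanish (L , size , L! , adj , w∈L , active) {v} (k , _)
  with remove L! w∈L
... | L′ , L′! , size′ , L′⊆ =
  Deg<-roots Root root-injective r (Deg<-poly r (nodes (suc d)) (ones (suc d)) c (embed code u)) L′ L′!
    (≤-reflexive (suc-injective (trans (sym size) size′)))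
    (All.map (λ { {x} (x∈L , x≢w) → _ ,
      (adj x x∈L , refl {x = code (proj₁ (adj x x∈L)) _}) , vanish (active x x∈L x≢w) (adj x x∈L) }) L′⊆)
    (code k (lookup v k))
  where
  Root : Vtx n d → ℤ → Set
  Root x a = ∃ λ (p : AdjK n d u x) → a ≡ code (proj₁ p) (lookup x (proj₁ p))
  -- A neighbour of `u` is determined by its direction and its value there.
  root-injective : ∀ {x y a} → Root x a → Root y a → x ≡ y
  root-injective {x} {y} ((i , _ , agree) , eq) ((j , _ , agree′) , eq′)
    with code-injective {k = i} {j} (trans (sym eq) eq′)
  ... | refl , xᵢ≡yᵢ = lookup-ext x y λ l → case l Fin.≟ i of λ
    { (yes refl) → xᵢ≡yᵢ ; (no l≢i) → trans (sym (agree l l≢i)) (agree′ l l≢i) }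

stage-vanishes : ∀ {n d} r c E₀ → (∀ {u v} → (u , v) ∈ E₀ → Vanishes r c u v) →
  ∀ i {u v} → Bootstrap.Stage (AdjK n d) r E₀ i u v → Vanishes r c u v
stage-vanishes r c E₀ vanish zero (inj₁ uv∈E₀) = vanish uv∈E₀
stage-vanishes r c E₀ vanish zero {u} {v} (inj₂ vu∈E₀) = vanishes-sym r c {v} {u} (vanish vu∈E₀)
stage-vanishes r c E₀ vanish (suc i) (inj₁ st) = stage-vanishes r c E₀ vanish i st
stage-vanishes r c E₀ vanish (suc i) {u} {v} (inj₂ (_ , inj₁ star)) =
  star-vanishes r c {A = Bootstrap.Stage (AdjK _ _) r E₀ i} {u} (λ {x} → stage-vanishes r c E₀ vanish i {u} {x}) star {v}
stage-vanishes r c E₀ vanish (suc i) {u} {v} (inj₂ (_ , inj₂ star)) =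
  vanishes-sym r c {v} {u} (star-vanishes r c {A = Bootstrap.Stage (AdjK _ _) r E₀ i} {v} (λ {x} → stage-vanishes r c E₀ vanish i {v} {x}) star {u})

edgeRows : ∀ {n d} r {E : List (Vtx n d × Vtx n d)} → All (uncurry (AdjK n d)) E →
  List (Vec ℤ (count (suc d) r))
edgeRows r = All.reduce λ { {u , v} (k , _) → edgeRow r u k (lookup v k) }

length-edgeRows : ∀ {n d} r {E : List (Vtx n d × Vtx n d)} (adj : All (uncurry (AdjK n d)) E) →
  length (edgeRows r adj) ≡ length E
length-edgeRows r []        = refl
length-edgeRows r (_ ∷ adj) = cong suc (length-edgeRows r adj)

edgeRows-vanish : ∀ {n d} r c {E : List (Vtx n d × Vtx n d)} (adj : All (uncurry (AdjK n d)) E) →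
  All (λ φ → dot c φ ≡ 0ℤ) (edgeRows r adj) → ∀ {u v} → (u , v) ∈ E → Vanishes r c u v
edgeRows-vanish r c {(u , v) ∷ _} (p ∷ _) (eq ∷ _) (here refl) q =
  subst (λ k → dot c (edgeRow r u k (lookup v k)) ≡ 0ℤ) (adj-direction-unique {u = u} {v} p q) eq
edgeRows-vanish r c (_ ∷ adj) (_ ∷ eqs) (there uv∈E) = edgeRows-vanish r c adj eqs uv∈E

-- The `n` neighbours of a vertex in the first direction give at least `r` roots, so the polynomial
-- vanishes at every `t`, including values that code no edge. The vertices then form a grid with at
-- least `r` values per coordinate, and `poly-injective` applies.
all-edges-vanish⇒zero : ∀ {n d} r c → r ≤ n →
  (∀ (u v : Vtx (suc n) (suc d)) → Vanishes r c u v) → Zero c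
all-edges-vanish⇒zero {n} {d} r c r≤n vanish =
  poly-injective (suc (suc d)) r b s
    (VecUnique.tabulate⁺ (Fin.toℕ-injective ∘ ℤ.+-injective)) (VecAll.tabulate⁺ {f = λ _ → 1ℤ} λ _ ()) c
    λ { (t ∷ xs) → poly-vanishes-from-grid r b (step b t s) c code (m≤n⇒m≤1+n r≤n)
          (λ i eq → proj₂ (code-injective {k = i} {i} eq)) (vertex-vanishes t) xs }
  where
  b = nodes (suc (suc d))
  s = ones (suc (suc d))
  vertex-vanishes : ∀ t u → poly r b s c (t ∷ embed code u) ≡ 0ℤ
  vertex-vanishes t u@(i ∷ x) =
    Deg<-roots (λ j a → a ≡ code {d = suc d} zero (punchIn i j))
      (λ {j} {l} eq eq′ → Fin.punchIn-injective i j l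
        (proj₂ (code-injective {k = zero {d}} {zero} (trans (sym eq) eq′))))
      r (Deg<-poly r b s c (embed code u)) (List.allFin n) (Unique.allFin⁺ n)
      (subst (r ≤_) (sym (length-tabulate {n = n} id)) r≤n)
      (All.universal (λ j → _ , refl , vanish u (punchIn i j ∷ x) (adj-head (Fin.punchInᵢ≢i i j)))
        (List.allFin n))
      t

percolating-length : ∀ n r d → r ≤ n → ∀ E₀ → Bootstrap.EdgeList (AdjK (suc n) (suc d)) E₀ →
  Bootstrap.Percolates (AdjK (suc n) (suc d)) r E₀ → count (suc (suc d)) r ≤ length E₀
percolating-length n r d r≤n E₀ edges percolates = ≮⇒≥ λ short →
  case kernel (edgeRows r adj) (subst (_< _) (sym (length-edgeRows r adj)) short) of λ
    { (c , c≢0 , c⊥) → c≢0 (all-edges-vanish⇒zero r c r≤n λ u v p →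
        stage-vanishes r c E₀ (edgeRows-vanish r c adj c⊥)
          (proj₁ (percolates u v p)) (proj₂ (percolates u v p)) p) }
  where
  adj : All (uncurry (AdjK (suc n) (suc d))) E₀
  adj = All.tabulate (λ { {u , v} → edges u v })

-- Percolation from the simplex

Active : ∀ {n d} → ℕ → List (Vtx n d × Vtx n d) → Vtx n d → Vtx n d → Set
Active {n} {d} r E₀ u v = ∃ λ i → Bootstrap.Stage (AdjK n d) r E₀ i u v

stage-sym : ∀ {n d} r E₀ i {u v : Vtx n d} →
  Bootstrap.Stage (AdjK n d) r E₀ i u v → Bootstrap.Stage (AdjK n d) r E₀ i v u
stage-sym r E₀ zero (inj₁ uv∈E₀) = inj₂ uv∈E₀
stage-sym r E₀ zero (inj₂ vu∈E₀) = inj₁ vu∈E₀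
stage-sym r E₀ (suc i) (inj₁ st) = inj₁ (stage-sym r E₀ i st)
stage-sym r E₀ (suc i) {u} {v} (inj₂ (adj , inj₁ star)) = inj₂ (adj-sym {u = u} {v} adj , inj₂ star)
stage-sym r E₀ (suc i) {u} {v} (inj₂ (adj , inj₂ star)) = inj₂ (adj-sym {u = u} {v} adj , inj₁ star)

stage-+ : ∀ {n d} r E₀ i k {u v : Vtx n d} →
  Bootstrap.Stage (AdjK n d) r E₀ i u v → Bootstrap.Stage (AdjK n d) r E₀ (k + i) u v
stage-+ r E₀ i zero    st = st
stage-+ r E₀ i (suc k) st = inj₁ (stage-+ r E₀ i k st)

common-stage : ∀ {n d} r E₀ {u : Vtx n d} {L} → All (Active r E₀ u) L →
  ∃ λ i → All (Bootstrap.Stage (AdjK n d) r E₀ i u) L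
common-stage r E₀ [] = 0 , []
common-stage r E₀ {u} {v ∷ _} ((i , st) ∷ sts) with common-stage r E₀ sts
... | j , sts′ = j + i , stage-+ r E₀ i j st ∷
  All.map (λ {w} → subst (λ k → Bootstrap.Stage (AdjK _ _) r E₀ k u w) (+-comm i j) ∘ stage-+ r E₀ j i) sts′

_≟-Vtx_ : ∀ {n d} → DecidableEquality (Vtx n d)
_≟-Vtx_ = Vec.≡-dec Fin._≟_

-- A star has exactly `r + 1` leaves, so `L` is cut to `r` entries. Either `w` is among them and
-- already active, or it joins them as the last leaf.
active-star : ∀ {n d} r E₀ {u : Vtx n d} (L : List (Vtx n d)) → Unique L → r ≤ length L →
  All (AdjK n d u) L → All (Active r E₀ u) L → ∀ w → AdjK n d u w → Active r E₀ u w
active-star {n} {d} r E₀ {u} L L! r≤L adj active w u~w with DecMembership._∈?_ _≟-Vtx_ w (List.take r L)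
... | yes w∈L = All.lookup (All.take⁺ r active) w∈L
... | no w∉L with common-stage r E₀ (All.take⁺ r active)
... | i , sts = suc i , inj₂ (u~w , inj₁ (w ∷ List.take r L ,
  cong suc (trans (length-take r L) (m≤n⇒m⊓n≡m r≤L)) ,
  (All.tabulate (λ { x∈L refl → w∉L x∈L }) ∷ Unique.take⁺ r L!) ,
  (λ { _ (here refl) → u~w ; _ (there x∈L) → All.lookup (All.take⁺ r adj) x∈L }) ,
  here refl ,
  λ { _ (here refl) w≢w → contradiction refl w≢w ; _ (there x∈L) _ → All.lookup sts x∈L }))

-- Neighbours and the coordinate sum

rank : ∀ {n d} → Vtx n d → ℕ
rank = Vec.sum ∘ Vec.map toℕ

punchIn≤suc : ∀ {n} (i : Fin (suc n)) k → toℕ (punchIn i k) ≤ suc (toℕ k)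
punchIn≤suc zero    k       = ≤-refl
punchIn≤suc (suc i) zero    = z≤n
punchIn≤suc (suc i) (suc k) = s≤s (punchIn≤suc i k)

-- For `toℕ i ≤ m` these are the values 0, ..., m other than `i`; in particular `m = toℕ i` gives
-- the values below `i`.
others : ∀ {n} (i : Fin (suc n)) m → m ≤ n → List (Fin (suc n))
others i m m≤n = List.map (λ k → punchIn i (inject≤ k m≤n)) (List.allFin m)

module _ {n} (i : Fin (suc n)) m (m≤n : m ≤ n) where

  others-unique : Unique (others i m m≤n)
  others-unique = Unique.map⁺
    (λ eq → Fin.inject≤-injective m≤n m≤n _ _ (Fin.punchIn-injective i _ _ eq)) (Unique.allFin⁺ m)

  length-others : length (others i m m≤n) ≡ m
  length-others = trans (length-map _ (List.allFin m)) (length-tabulate {n = m} id)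

  others-bounds : All (λ y → y ≢ i × toℕ y ≤ m) (others i m m≤n)
  others-bounds = All.map⁺ (All.universal (λ k → Fin.punchInᵢ≢i i _ ,
    ≤-trans (punchIn≤suc i (inject≤ k m≤n)) (subst (_< m) (sym (Fin.toℕ-inject≤ k m≤n)) (Fin.toℕ<n k)))
    (List.allFin m))

fan : ∀ {n d} → Vtx n (suc d) → List (Fin n) → List (Vtx n d) → List (Vtx n (suc d))
fan (i ∷ x) ys zs = List.map (_∷ x) ys ++ List.map (i ∷_) zs

fan-unique : ∀ {n d} (x : Vtx n (suc d)) {ys zs} → Unique ys → All (_≢ Vec.head x) ys → Unique zs →
  Unique (fan x ys zs)
fan-unique (i ∷ x) ys! ys≢i zs! =
  Unique.++⁺ (Unique.map⁺ (λ { refl → refl }) ys!) (Unique.map⁺ (λ { refl → refl }) zs!)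
  λ { (v∈ys , v∈zs) → case (∈-map⁻ (_∷ x) v∈ys , ∈-map⁻ (i ∷_) v∈zs) of
    λ { ((_ , y∈ys , refl) , (_ , _ , refl)) → All.lookup ys≢i y∈ys refl } }

length-fan : ∀ {n d} (x : Vtx n (suc d)) ys zs → length (fan x ys zs) ≡ length ys + length zs
length-fan (i ∷ x) ys zs = trans (length-++ (List.map (_∷ x) ys))
  (cong₂ _+_ (length-map (_∷ x) ys) (length-map (i ∷_) zs))

lower : ∀ {n d} → Vtx (suc n) d → List (Vtx (suc n) d)
lower []        = []
lower x@(i ∷ x′) = fan x (others i (toℕ i) (Fin.toℕ≤pred[n] i)) (lower x′)

lower-unique : ∀ {n d} (x : Vtx (suc n) d) → Unique (lower x)
lower-unique []         = []
lower-unique x@(i ∷ x′) = fan-unique x (others-unique i (toℕ i) (Fin.toℕ≤pred[n] i))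
  (All.map proj₁ (others-bounds i (toℕ i) (Fin.toℕ≤pred[n] i))) (lower-unique x′)

-- A coordinate of value `i` can be lowered in `i` ways.
length-lower : ∀ {n d} (x : Vtx (suc n) d) → length (lower x) ≡ rank x
length-lower []         = refl
length-lower x@(i ∷ x′) = trans (length-fan x (others i (toℕ i) (Fin.toℕ≤pred[n] i)) (lower x′))
  (cong₂ _+_ (length-others i (toℕ i) (Fin.toℕ≤pred[n] i)) (length-lower x′))

lower-bounds : ∀ {n d} (x : Vtx (suc n) d) → All (λ y → AdjK (suc n) d x y × rank y < rank x) (lower x)
lower-bounds []      = []
lower-bounds (i ∷ x) = All.++⁺
  (All.map⁺ (All.map (λ { (y≢i , y≤i) → adj-head y≢i ,
    +-monoˡ-< (rank x) (≤∧≢⇒< y≤i (y≢i ∘ Fin.toℕ-injective)) }) (others-bounds i (toℕ i) (Fin.toℕ≤pred[n] i))))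
  (All.map⁺ (All.map (λ { {y} (x~y , y<x) → adj-tail {x = x} {y} x~y , +-monoʳ-< (toℕ i) y<x }) (lower-bounds x)))

-- The seed and its percolation

incrementHead : ∀ {D} → Vec ℕ (suc D) → Vec ℕ (suc D)
incrementHead (a ∷ v) = suc a ∷ v

simplex : ∀ D → ℕ → List (Vec ℕ D)
simplex D       zero    = []
simplex zero    (suc r) = [] ∷ []
simplex (suc D) (suc r) = List.map (0 ∷_) (simplex D (suc r)) ++ List.map incrementHead (simplex (suc D) r)

length-simplex : ∀ D r → length (simplex D r) ≡ count D r
length-simplex D       zero    = refl
length-simplex zero    (suc r) = refl
length-simplex (suc D) (suc r) = trans (length-++ (List.map (0 ∷_) (simplex D (suc r))))
  (cong₂ _+_ (trans (length-map _ (simplex D (suc r))) (length-simplex D (suc r)))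
             (trans (length-map _ (simplex (suc D) r)) (length-simplex (suc D) r)))

simplex-complete : ∀ {D} r (v : Vec ℕ D) → Vec.sum v < r → v ∈ simplex D r
simplex-complete (suc r) []          _         = here refl
simplex-complete (suc r) (zero  ∷ v) v<r       = ∈-++⁺ˡ (∈-map⁺ (0 ∷_) (simplex-complete (suc r) v v<r))
simplex-complete (suc r) (suc a ∷ v) (s≤s v<r) =
  ∈-++⁺ʳ _ (∈-map⁺ incrementHead (simplex-complete r (a ∷ v) v<r))

clamp : ∀ {n} → ℕ → Fin (suc n)
clamp         zero    = zero
clamp {zero}  (suc m) = zero
clamp {suc n} (suc m) = suc (clamp m)

clamp-toℕ : ∀ {n} (i : Fin (suc n)) → clamp (toℕ i) ≡ i
clamp-toℕ         zero    = refl
clamp-toℕ {suc n} (suc i) = cong suc (clamp-toℕ i)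

clamps-toℕ : ∀ {n d} (x : Vtx (suc n) d) → Vec.map clamp (Vec.map toℕ x) ≡ x
clamps-toℕ []      = refl
clamps-toℕ (i ∷ x) = cong₂ _∷_ (clamp-toℕ i) (clamps-toℕ x)

-- The raise `suc j` is at least 1. A coordinate sum less than `r` for the whole argument means that
-- the raise is at most `r` minus the coordinate sum of the lower end.
forwardEdge : ∀ {n d} → Vec ℕ (suc (suc d)) → Vtx (suc n) (suc d) × Vtx (suc n) (suc d)
forwardEdge (j ∷ a ∷ α) = clamp a ∷ Vec.map clamp α , clamp (a + suc j) ∷ Vec.map clamp α

adj? : ∀ {n d} (u v : Vtx n d) → Dec (AdjK n d u v)
adj? u v = Fin.any? λ k → ¬? (lookup u k Fin.≟ lookup v k) ×-dec
  Fin.all? λ j → ¬? (j Fin.≟ k) →-dec (lookup u j Fin.≟ lookup v j)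

_≟-Edge_ : ∀ {n d} → DecidableEquality (Vtx n d × Vtx n d)
_≟-Edge_ = ×-≡-dec _≟-Vtx_ _≟-Vtx_

-- Filtering and deduplicating make `EdgeList` and `Unique` hold by construction.
seed : ∀ n r d → List (Vtx (suc n) (suc d) × Vtx (suc n) (suc d))
seed n r d = List.deduplicate _≟-Edge_ (List.filter (uncurry adj?) (List.map forwardEdge (simplex (suc (suc d)) r)))

seed-edges : ∀ n r d → Bootstrap.EdgeList (AdjK (suc n) (suc d)) (seed n r d)
seed-edges n r d u v uv∈ = proj₂ (∈-filter⁻ (uncurry adj?) {xs = List.map forwardEdge (simplex (suc (suc d)) r)}
  (∈-deduplicate⁻ _≟-Edge_ (List.filter (uncurry adj?) (List.map forwardEdge (simplex (suc (suc d)) r))) uv∈))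

length-seed : ∀ n r d → length (seed n r d) ≤ count (suc (suc d)) r
length-seed n r d = begin
  length (seed n r d)               ≤⟨ length-deduplicate _≟-Edge_ (List.filter (uncurry adj?) E) ⟩
  length (List.filter (uncurry adj?) E) ≤⟨ length-filter (uncurry adj?) E ⟩
  length E                          ≡⟨ length-map forwardEdge (simplex (suc (suc d)) r) ⟩
  length (simplex (suc (suc d)) r)  ≡⟨ length-simplex (suc (suc d)) r ⟩
  count (suc (suc d)) r             ∎
  where
  open ≤-Reasoning
  E = List.map (forwardEdge {n}) (simplex (suc (suc d)) r)

∈-seed : ∀ {n d} r (i y : Fin (suc n)) (x : Vtx (suc n) d) j → toℕ y ≡ toℕ i + suc j →
  j + rank (i ∷ x) < r → (i ∷ x , y ∷ x) ∈ seed n r d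
∈-seed {n} {d} r i y x j y≡ small = ∈-deduplicate⁺ _≟-Edge_ (∈-filter⁺ (uncurry adj?)
  (subst (_∈ List.map forwardEdge (simplex (suc (suc d)) r)) forward≡
    (∈-map⁺ forwardEdge (simplex-complete r (j ∷ Vec.map toℕ (i ∷ x)) small)))
  (adj-head λ { refl → m≢1+m+n (toℕ i) (trans y≡ (+-suc (toℕ i) j)) }))
  where
  forward≡ : forwardEdge (j ∷ toℕ i ∷ Vec.map toℕ x) ≡ (i ∷ x , y ∷ x)
  forward≡ = cong₂ _,_ (clamps-toℕ (i ∷ x))
    (cong₂ _∷_ (trans (cong clamp (sym y≡)) (clamp-toℕ y)) (clamps-toℕ x))

-- Induction on the coordinate sum |x|: the |x| neighbours of x with a smaller
-- coordinate are already saturated, and the seed contains r ∸ |x| further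
-- edges at x.
seed-percolates : ∀ n r d → r ≤ n → Bootstrap.Percolates (AdjK (suc n) (suc d)) r (seed n r d)
seed-percolates n r d r≤n u v = saturated (suc (rank u)) u ≤-refl v
  where
  saturated : ∀ s x → rank x < s → ∀ w → AdjK (suc n) (suc d) x w → Active r (seed n r d) x w
  saturated (suc s) x@(i ∷ x′) (s≤s x≤s) = active-star r (seed n r d) L
    (fan-unique x (others-unique i m m≤n) (All.map proj₁ (others-bounds i m m≤n)) (lower-unique x′))
    r≤L
    (All.++⁺ (All.map⁺ (All.map (λ { (y≢i , _) → adj-head y≢i }) (others-bounds i m m≤n)))
             (All.map⁺ (All.map (λ { {y} (x′~y , _) → adj-tail {x = x′} {y} x′~y }) (lower-bounds x′))))
    (All.++⁺ (All.map⁺ (All.map (λ { {y} (y≢i , y≤m) → active-head y y≢i y≤m }) (others-bounds i m m≤n)))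
             (All.map⁺ (All.map (λ { {y} (x′~y , y<x′) →
                active-smaller (i ∷ y) (adj-tail {x = x′} {y} x′~y) (+-monoʳ-< (toℕ i) y<x′) }) (lower-bounds x′))))
    where
    -- `others i m` holds the `toℕ i` values below `i` and the `r ∸ rank x` values just above it;
    -- with `lower x′` this makes at least `r` neighbours.
    m = toℕ i + (r ∸ rank x)

    -- The raised values stay in range: `toℕ i ≤ rank x` bounds `m` by `r`, unless nothing is
    -- raised.
    m≤n : m ≤ n
    m≤n with ≤-total r (rank x)
    ... | inj₁ r≤x = subst (_≤ n) (sym (trans (cong (toℕ i +_) (m≤n⇒m∸n≡0 r≤x)) (+-identityʳ (toℕ i))))
      (Fin.toℕ≤pred[n] i)
    ... | inj₂ x≤r = begin
      toℕ i + (r ∸ rank x)  ≤⟨ +-monoʳ-≤ (toℕ i) (∸-monoʳ-≤ r i≤x) ⟩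
      toℕ i + (r ∸ toℕ i)   ≡⟨ m+[n∸m]≡n (≤-trans i≤x x≤r) ⟩
      r                     ≤⟨ r≤n ⟩
      n                     ∎
      where
      open ≤-Reasoning
      i≤x : toℕ i ≤ rank x
      i≤x = m≤m+n (toℕ i) (rank x′)

    L = fan x (others i m m≤n) (lower x′)

    r≤L : r ≤ length L
    r≤L = begin
      r                                       ≤⟨ m≤n+m∸n r (rank x) ⟩
      toℕ i + rank x′ + (r ∸ rank x)          ≡⟨ +-assoc (toℕ i) (rank x′) (r ∸ rank x) ⟩
      toℕ i + (rank x′ + (r ∸ rank x))        ≡⟨ cong (toℕ i +_) (+-comm (rank x′) (r ∸ rank x)) ⟩
      toℕ i + ((r ∸ rank x) + rank x′)        ≡⟨ +-assoc (toℕ i) (r ∸ rank x) (rank x′) ⟨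
      m + rank x′                             ≡⟨ cong₂ _+_ (length-others i m m≤n) (length-lower x′) ⟨
      length (others i m m≤n) + length (lower x′) ≡⟨ length-fan x (others i m m≤n) (lower x′) ⟨
      length L                                ∎
      where open ≤-Reasoning

    active-smaller : ∀ y → AdjK (suc n) (suc d) x y → rank y < rank x → Active r (seed n r d) x y
    active-smaller y x~y y<x with saturated s y (≤-trans y<x x≤s) x (adj-sym {u = x} {y} x~y)
    ... | k , st = k , stage-sym r (seed n r d) k st

    active-head : ∀ y → y ≢ i → toℕ y ≤ m → Active r (seed n r d) x (y ∷ x′)
    active-head y y≢i y≤m with <-cmp (toℕ y) (toℕ i)
    ... | tri< y<i _ _ = active-smaller (y ∷ x′) (adj-head y≢i) (+-monoˡ-< (rank x′) y<i)
    ... | tri≈ _ y≡i _ = contradiction (Fin.toℕ-injective y≡i) y≢i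
    ... | tri> _ _ i<y with m≤n⇒∃[o]m+o≡n i<y
    -- Here `j` is one less than the raise of the first coordinate, as in `forwardEdge`.
    ... | j , i+j≡y = 0 , inj₁ (∈-seed r i y x′ j y≡ small)
      where
      y≡ : toℕ y ≡ toℕ i + suc j
      y≡ = trans (sym i+j≡y) (sym (+-suc (toℕ i) j))
      gap : suc j ≤ r ∸ rank x
      gap = +-cancelˡ-≤ (toℕ i) _ _ (subst (_≤ m) y≡ y≤m)
      -- By `gap` the difference `r ∸ rank x` is positive, hence `rank x < r`, and the truncated
      -- subtraction can be undone.
      small : j + rank x < r
      small = m≤o∸n⇒m+n≤o (suc j) (<⇒≤ (m∸n≢0⇒n<m λ eq → n≮0 (subst (suc j ≤_) eq gap))) gap

theorem3p6 : (n r d : ℕ) → 1 ≤ n → 1 ≤ r → 1 ≤ d → suc r ≤ n →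
    Bootstrap.MeEquals (AdjK n d) r ((d + r) C (suc d))
theorem3p6 (suc n) r (suc d) _ _ _ (s≤s r≤n) rewrite sym (count≡C (suc d) r) =
  (seed n r d , seed-edges n r d , DecUnique.deduplicate-! _≟-Edge_ _ , seed-percolates n r d r≤n ,
    ≤-antisym (length-seed n r d)
      (percolating-length n r d r≤n (seed n r d) (seed-edges n r d) (seed-percolates n r d r≤n))) ,
  percolating-length n r d r≤n
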